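{- (Isomorphism Theorem) Let $A\subseteq\omega$ be an infinite c.e. set. Any two quasi-Gödel numberings $\theta,\theta'$ of $\mathcal S^{(1)}_A$ are computably isomorphic, i.e. there is a computable bijection $g:\omega\to\omega$ with $\theta_i=\theta'_{g(i)}$ for all $i\in\omega$.
   Context: $\omega$ is the set of natural numbers; $\mathcal R^{(n)}$ is the set of total computable functions $\omega^n\to\omega$. $\langle\cdot,\cdot\rangle:\omega^2\to\omega$ is a computable bijection with $\langle x,y\rangle\ge x,y$. $\mathrm{Anf}^{(1)}_A$ is the set of partial functions from $\omega$ to $\omega$ whose domain is either empty or equal to $\{0,\dots,a-1\}$ for some $a\in A$, and $\mathcal S^{(1)}_A=\mathcal R^{(1)}\cup\mathrm{Anf}^{(1)}_A$. The extended graph of a unary partial function $q$ is $\{\langle y,0\rangle:y\in\omega\}\cup\{\langle x,q(x)+1\rangle:x\in\mathrm{dom}(q)\}$; that of a binary partial function $q$ is $\{\langle\langle y,y'\rangle,0\rangle:y,y'\in\omega\}\cup\{\langle\langle x,x'\rangle,q(x,x')+1\rangle:(x,x')\in\mathrm{dom}(q)\}$. A numbering of a set $X$ is a surjection $\omega\to X$. A numbering $\theta$ of $\mathcal S^{(1)}_A$ is a quasi-Gödel numbering if: (QGN I) the extended graph of $(i,x)\mapsto\theta_i(x)$ is the range of a function in $\mathcal R^{(1)}$; and (QGN II) for every $k\in\mathcal R^{(2)}$ there is $v\in\mathcal R^{(1)}$ such that for all $i\in\omega$, $r\in\mathcal S^{(1)}_A$: if $\{k(i,t):t\in\omega\}$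 is the extended graph of $r$, then $r=\theta_{v(i)}$. -}

module Defs where

open import Data.Fin.Base using (Fin)
open import Data.Nat.Base using (ℕ; suc; _<_; _≤_)
open import Data.Product.Base using (∃; ∃₂; ∃-syntax; _×_; _,_; uncurry)
open import Data.Sum.Base using (_⊎_)
open import Data.Vec.Base using (Vec; []; _∷_; lookup)
open import Data.Vec.Relation.Binary.Pointwise.Inductive using (Pointwise)
open import Function.Definitions using (Bijective)
open import Level using (0ℓ) renaming (suc to lsuc)
open import Relation.Binary.Core using (REL) renaming (_⇔_ to _⇔ᵣ_)
open import Relation.Binary.PropositionalEquality
  using (_≡_; sym; trans)
open import Relation.Unary using (Pred; _∈_; _≐_; _∪_; Empty)

-- Partial recursive functions: codes and their call-by-value evaluation.

data Code : ℕ → Set where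
  zer  : ∀ {n} → Code n
  succ : Code 1
  proj : ∀ {n} → Fin n → Code n
  comp : ∀ {m n} → Code m → Vec (Code n) m → Code n
  prec : ∀ {n} → Code n → Code (suc (suc n)) → Code (suc n)
  mu   : ∀ {n} → Code (suc n) → Code n

infix 4 _[_]↦_

-- In  prec g h  the recursion is on the first argument, and h receives the
-- predecessor, the value there, and the parameters, in this order.  mu f
-- requires f to be defined at every argument below the first zero.

data _[_]↦_ : ∀ {n} → Code n → Vec ℕ n → ℕ → Set where
  ev-zer   : ∀ {n} {xs : Vec ℕ n} → zer [ xs ]↦ 0
  ev-succ  : ∀ {x} → succ [ x ∷ [] ]↦ suc x
  ev-proj  : ∀ {n} {i : Fin n} {xs} → proj i [ xs ]↦ lookup xs i
  ev-comp  : ∀ {m n} {f : Code m} {gs : Vec (Code n) m} {xs ys z} →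
             Pointwise (λ g y → g [ xs ]↦ y) gs ys →
             f [ ys ]↦ z →
             comp f gs [ xs ]↦ z
  ev-prec₀ : ∀ {n} {g : Code n} {h xs z} →
             g [ xs ]↦ z →
             prec g h [ 0 ∷ xs ]↦ z
  ev-precₛ : ∀ {n} {g : Code n} {h k xs y z} →
             prec g h [ k ∷ xs ]↦ y →
             h [ k ∷ y ∷ xs ]↦ z →
             prec g h [ suc k ∷ xs ]↦ z
  ev-mu    : ∀ {n} {f : Code (suc n)} {xs k} →
             f [ k ∷ xs ]↦ 0 →
             (∀ j → j < k → ∃[ v ] f [ j ∷ xs ]↦ suc v) →
             mu f [ xs ]↦ k

ℛ : ∀ n → Pred (Vec ℕ n → ℕ) 0ℓ
ℛ n f = ∃[ c ] (∀ xs → c [ xs ]↦ f xs)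

ℛ₁ : Pred (ℕ → ℕ) 0ℓ
ℛ₁ f = ℛ 1 λ { (x ∷ []) → f x }

ℛ₂ : Pred (ℕ → ℕ → ℕ) 0ℓ
ℛ₂ f = ℛ 2 λ { (x ∷ y ∷ []) → f x y }

Range : (ℕ → ℕ) → Pred ℕ 0ℓ
Range f y = ∃[ x ] f x ≡ y

CE : Pred (Pred ℕ 0ℓ) 0ℓ
CE A = Empty A ⊎ (∃[ f ] ℛ₁ f × A ≐ Range f)

record Pairing : Set where
  field
    ⟨_,_⟩      : ℕ → ℕ → ℕ
    computable : ⟨_,_⟩ ∈ ℛ₂
    bijective  : Bijective _≡_ _≡_ (uncurry ⟨_,_⟩)
    ≥-fst      : ∀ x y → x ≤ ⟨ x , y ⟩
    ≥-snd      : ∀ x y → y ≤ ⟨ x , y ⟩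

-- Arbitrary, not necessarily computable, partial functions, given by their
-- graphs.  (Values in Maybe ℕ would force domains to be decidable.)

record PFun (D : Set) : Set₁ where
  field
    graph      : REL D ℕ 0ℓ
    functional : ∀ {x y z} → graph x y → graph x z → y ≡ z

open PFun public

dom : ∀ {D} → PFun D → Pred D 0ℓ
dom q x = ∃[ y ] graph q x y

infix 4 _≈_

_≈_ : ∀ {D} → PFun D → PFun D → Set
q ≈ r = graph q ⇔ᵣ graph r

total : (ℕ → ℕ) → PFun ℕ
total f = record
  { graph      = λ x y → f x ≡ y
  ; functional = λ p q → trans (sym p) q
  }

uncurryᵖ : (ℕ → PFun ℕ) → PFun (ℕ × ℕ)
uncurryᵖ θ = record
  { graph      = λ (i , x) → graph (θ i) x
  ; functional = λ {(i , _)} → functional (θ i)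
  }

Computable : Pred (PFun ℕ) 0ℓ
Computable q = ∃[ f ] ℛ₁ f × q ≈ total f

Anf : Pred ℕ 0ℓ → Pred (PFun ℕ) 0ℓ
Anf A q = Empty (dom q) ⊎ (∃[ a ] a ∈ A × dom q ≐ (_< a))

𝒮 : Pred ℕ 0ℓ → Pred (PFun ℕ) 0ℓ
𝒮 A = Computable ∪ Anf A

record IsNumbering (X : Pred (PFun ℕ) 0ℓ) (θ : ℕ → PFun ℕ) : Set₁ where
  field
    member : ∀ i → θ i ∈ X
    onto   : ∀ r → r ∈ X → ∃[ i ] r ≈ θ i

module _ (P : Pairing) where
  open Pairing P using (⟨_,_⟩)

  extendedGraph₁ : PFun ℕ → Pred ℕ 0ℓ
  extendedGraph₁ q z =
    (∃[ y ] z ≡ ⟨ y , 0 ⟩) ⊎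
    (∃₂ λ x v → graph q x v × z ≡ ⟨ x , suc v ⟩)

  extendedGraph₂ : PFun (ℕ × ℕ) → Pred ℕ 0ℓ
  extendedGraph₂ q z =
    (∃₂ λ y y′ → z ≡ ⟨ ⟨ y , y′ ⟩ , 0 ⟩) ⊎
    (∃[ x ] ∃[ x′ ] ∃[ v ] graph q (x , x′) v × z ≡ ⟨ ⟨ x , x′ ⟩ , suc v ⟩)

  record IsQuasiGödelNumbering
    (A : Pred ℕ 0ℓ) (θ : ℕ → PFun ℕ) : Set₁ where
    field
      isNumbering : IsNumbering (𝒮 A) θ
      QGN-I       : ∃[ f ] ℛ₁ f × extendedGraph₂ (uncurryᵖ θ) ≐ Range f
      QGN-II      : ∀ k → ℛ₂ k → ∃[ v ] ℛ₁ v ×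
                    (∀ i r → r ∈ 𝒮 A →
                     Range (k i) ≐ extendedGraph₁ r → r ≈ θ (v i))

{-# OPTIONS --safe #-}
module Submission where

-- Quasi-Gödel numberings satisfy the recursion theorem, which gives padding: for i, b
-- and each j, let e_j be an index in θ′ that behaves as θ_i if e_j > b and as the
-- constant function j otherwise.  Among j ≤ b + 1 some e_j exceeds b, since otherwise
-- two of them coincide while indexing different constants.  This yields computable
-- injective reductions a of θ to θ′ and c of θ′ to θ with a n, c n > n.  The backward
-- Cantor–Bernstein chain n ← c⁻¹ n ← a⁻¹ (c⁻¹ n) ← ⋯ is then strictly decreasing, so its
-- origin can be computed and the Cantor–Bernstein bijection is computable.

open import Defs
open import Data.Fin.Base using (Fin; zero; suc; toℕ; fromℕ<)
open import Data.Fin.Patterns using (0F; 1F; 2F; 3F)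
open import Data.Fin.Properties using (pigeonhole; toℕ-fromℕ<; toℕ<n)
open import Data.Nat.Base
open import Data.Nat.GeneralisedArithmetic using (iterate; iterate-is-fold)
open import Data.Nat.InfinitelyOften using (Inf)
open import Data.Nat.Properties
open import Data.Product.Base using (∃; ∃-syntax; _×_; _,_; proj₁; proj₂)
open import Data.Sum.Base using (_⊎_; inj₁; inj₂)
open import Data.Vec.Base using (Vec; []; _∷_; head; lookup; tabulate; tail)
open import Data.Vec.Properties using (tabulate∘lookup)
open import Data.Vec.Relation.Binary.Pointwise.Inductive using (Pointwise; tabulate⁺)
open import Function.Base using (_∘_; id)
open import Function.Definitions using (Bijective; Injective)
open import Level using (0ℓ)
open import Relation.Binary.Definitions using (tri<; tri≈; tri>)
open import Relation.Binary.PropositionalEquality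
open import Relation.Nullary using (¬_; yes; no; contradiction)
open import Relation.Unary using (Pred; _∈_; _≐_)

-- Closure properties of the computable functions

ℛ₃ : Pred (ℕ → ℕ → ℕ → ℕ) 0ℓ
ℛ₃ f = ℛ 3 λ { (x ∷ y ∷ z ∷ []) → f x y z }

ℛ-ext : ∀ {n} {f g : Vec ℕ n → ℕ} → (∀ xs → f xs ≡ g xs) → ℛ n f → ℛ n g
ℛ-ext f≗g (c , ev) = c , λ xs → subst (c [ xs ]↦_) (f≗g xs) (ev xs)

ℛ-subst : ∀ {m n} {f : Vec ℕ m → ℕ} {σ : Vec ℕ n → Vec ℕ m} →
          ℛ m f → (∀ i → ℛ n (λ xs → lookup (σ xs) i)) → ℛ n (f ∘ σ)
ℛ-subst {σ = σ} (c , ev) σᶜ =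
  comp c (tabulate (proj₁ ∘ σᶜ)) , λ xs →
  ev-comp (subst (Pointwise _ _) (tabulate∘lookup (σ xs))
                 (tabulate⁺ λ i → proj₂ (σᶜ i) xs))
          (ev (σ xs))

module _ {n : ℕ} where

  var : (i : Fin n) → ℛ n (λ xs → lookup xs i)
  var i = proj i , λ _ → ev-proj

  app₁ : ∀ {g} {f : Vec ℕ n → ℕ} → ℛ₁ g → ℛ n f → ℛ n (λ xs → g (f xs))
  app₁ {f = f} g f₀ = ℛ-subst {σ = λ xs → f xs ∷ []} g λ { 0F → f₀ }

  app₂ : ∀ {g} {f₀ f₁ : Vec ℕ n → ℕ} → ℛ₂ g → ℛ n f₀ → ℛ n f₁ →
         ℛ n (λ xs → g (f₀ xs) (f₁ xs))
  app₂ {f₀ = f₀} {f₁} g c₀ c₁ =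
    ℛ-subst {σ = λ xs → f₀ xs ∷ f₁ xs ∷ []} g λ { 0F → c₀ ; 1F → c₁ }

  app₃ : ∀ {g} {f₀ f₁ f₂ : Vec ℕ n → ℕ} → ℛ₃ g →
         ℛ n f₀ → ℛ n f₁ → ℛ n f₂ → ℛ n (λ xs → g (f₀ xs) (f₁ xs) (f₂ xs))
  app₃ {f₀ = f₀} {f₁} {f₂} g c₀ c₁ c₂ =
    ℛ-subst {σ = λ xs → f₀ xs ∷ f₁ xs ∷ f₂ xs ∷ []} g
            λ { 0F → c₀ ; 1F → c₁ ; 2F → c₂ }

  bind : ∀ {f : Vec ℕ n → ℕ} {g} → ℛ n f → ℛ (suc n) g →
         ℛ n (λ xs → g (f xs ∷ xs))
  bind {f} f₀ g =
    ℛ-subst {σ = λ xs → f xs ∷ xs} g λ { zero → f₀ ; (suc i) → var i }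

  -- Asks only for the two recursion equations of a given `h`, which mostly hold by `refl` when `h`
  -- is defined by pattern matching.
  rec : ∀ {f g} {h : Vec ℕ (suc n) → ℕ} → ℛ n f → ℛ (suc (suc n)) g →
        (∀ xs → f xs ≡ h (0 ∷ xs)) →
        (∀ k xs → g (k ∷ h (k ∷ xs) ∷ xs) ≡ h (suc k ∷ xs)) →
        ℛ (suc n) h
  rec {h = h} (c , ev) (d , ev′) base step = prec c d , λ { (k ∷ xs) → go k xs }
    where
    go : ∀ k xs → prec c d [ k ∷ xs ]↦ h (k ∷ xs)
    go zero    xs = subst (prec c d [ _ ]↦_) (base xs) (ev-prec₀ (ev xs))
    go (suc k) xs = subst (prec c d [ _ ]↦_) (step k xs) (ev-precₛ (go k xs) (ev′ _))

  zero-ℛ : ℛ n (λ _ → 0)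
  zero-ℛ = zer , λ _ → ev-zer

curry₁ : ∀ {f} → ℛ 1 f → ℛ₁ (λ x → f (x ∷ []))
curry₁ = ℛ-ext λ { (_ ∷ []) → refl }

curry₂ : ∀ {f} → ℛ 2 f → ℛ₂ (λ x y → f (x ∷ y ∷ []))
curry₂ = ℛ-ext λ { (_ ∷ _ ∷ []) → refl }

curry₃ : ∀ {f} → ℛ 3 f → ℛ₃ (λ x y z → f (x ∷ y ∷ z ∷ []))
curry₃ = ℛ-ext λ { (_ ∷ _ ∷ _ ∷ []) → refl }

suc-ℛ : ℛ₁ suc
suc-ℛ = succ , λ { (_ ∷ []) → ev-succ }

pred-ℛ : ℛ₁ pred
pred-ℛ = rec zero-ℛ (var 0F) (λ { [] → refl }) (λ { _ [] → refl })

-- The arguments are swapped because `prec` recurses on the first one, while truncated subtraction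
-- recurses on the subtrahend.
flipped-∸-ℛ : ℛ₂ (λ n m → m ∸ n)
flipped-∸-ℛ = rec (var 0F) (app₁ pred-ℛ (var 1F))
  (λ { (_ ∷ []) → refl }) (λ { k (m ∷ []) → pred[m∸n]≡m∸[1+n] m k })

const-ℛ : ∀ {n} c → ℛ n (λ _ → c)
const-ℛ zero    = zero-ℛ
const-ℛ (suc c) = app₁ suc-ℛ (const-ℛ c)

ifZero : ℕ → ℕ → ℕ → ℕ
ifZero zero    x y = x
ifZero (suc _) x y = y

ifZero-ℛ : ℛ₃ ifZero
ifZero-ℛ = rec (var 0F) (var 3F)
  (λ { (_ ∷ _ ∷ []) → refl }) (λ { _ (_ ∷ _ ∷ []) → refl })

opaque

  ifLe : ℕ → ℕ → ℕ → ℕ → ℕ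
  ifLe a b = ifZero (a ∸ b)

  ifLe-yes : ∀ {a b x y} → a ≤ b → ifLe a b x y ≡ x
  ifLe-yes a≤b rewrite m≤n⇒m∸n≡0 a≤b = refl

  ifLe-no : ∀ {a b x y} → ¬ a ≤ b → ifLe a b x y ≡ y
  ifLe-no {a} {b} a≰b with a ∸ b in eq
  ... | zero  = contradiction (m∸n≡0⇒m≤n eq) a≰b
  ... | suc _ = refl

  ifLe-ℛ : ∀ {n} {a b x y : Vec ℕ n → ℕ} → ℛ n a → ℛ n b → ℛ n x → ℛ n y →
           ℛ n (λ xs → ifLe (a xs) (b xs) (x xs) (y xs))
  ifLe-ℛ aᶜ bᶜ = app₃ ifZero-ℛ (app₂ flipped-∸-ℛ bᶜ aᶜ)

  ifEq : ℕ → ℕ → ℕ → ℕ → ℕ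
  ifEq a b x y = ifLe a b (ifLe b a x y) y

  ifEq-yes : ∀ {a b x y} → a ≡ b → ifEq a b x y ≡ x
  ifEq-yes a≡b = trans (ifLe-yes (≤-reflexive a≡b)) (ifLe-yes (≤-reflexive (sym a≡b)))

  ifEq-no : ∀ {a b x y} → a ≢ b → ifEq a b x y ≡ y
  ifEq-no {a} {b} a≢b with a ≤? b
  ... | no  a≰b = ifLe-no a≰b
  ... | yes a≤b = trans (ifLe-yes a≤b) (ifLe-no λ b≤a → a≢b (≤-antisym a≤b b≤a))

  ifEq-ℛ : ∀ {n} {a b x y : Vec ℕ n → ℕ} → ℛ n a → ℛ n b → ℛ n x → ℛ n y →
           ℛ n (λ xs → ifEq (a xs) (b xs) (x xs) (y xs))
  ifEq-ℛ aᶜ bᶜ xᶜ yᶜ = ifLe-ℛ aᶜ bᶜ (ifLe-ℛ bᶜ aᶜ xᶜ yᶜ) yᶜ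

ifEq-true : ∀ {a b} → ifEq a b 0 1 ≡ 0 → a ≡ b
ifEq-true {a} {b} eq with a ≟ b
... | yes a≡b = a≡b
... | no  a≢b = contradiction (trans (sym eq) (ifEq-no a≢b)) 0≢1+n

-- The largest m < n with p m ≡ 0, or 0 if there is none.
search : (ℕ → ℕ) → ℕ → ℕ
search p zero    = 0
search p (suc n) = ifZero (p n) n (search p n)

search-finds : ∀ (p : ℕ → ℕ) n {m} → m < n → p m ≡ 0 → p (search p n) ≡ 0
search-finds p (suc n) {m} m<1+n pm≡0 with p n in eq
... | zero  = eq
... | suc _ with m≤n⇒m<n∨m≡n (≤-pred m<1+n)
...   | inj₁ m<n  = search-finds p n m<n pm≡0
...   | inj₂ refl = contradiction (trans (sym pm≡0) eq) 0≢1+n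

search-ℛ : ∀ {n} {p : Vec ℕ (suc n) → ℕ} {b} → ℛ (suc n) p → ℛ n b →
           ℛ n (λ xs → search (λ m → p (m ∷ xs)) (b xs))
search-ℛ {n} {p} pᶜ bᶜ = bind bᶜ
  (rec {h = λ xs → search (λ m → p (m ∷ tail xs)) (head xs)}
    zero-ℛ (app₃ ifZero-ℛ p∘drop₁ (var 0F) (var 1F))
    (λ _ → refl) (λ _ _ → refl))
  where
  -- The recursion step also receives the value found so far; `p` has to skip that second variable.
  p∘drop₁ : ℛ (suc (suc n)) (λ xs → p (head xs ∷ tail (tail xs)))
  p∘drop₁ = ℛ-subst pᶜ λ
    { zero    → proj zero          , λ { (_ ∷ _ ∷ _) → ev-proj }
    ; (suc i) → proj (suc (suc i)) , λ { (_ ∷ _ ∷ _) → ev-proj } }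

iterate-ℛ : ∀ {f} → ℛ₁ f → ℛ₂ (λ n x → iterate f x n)
iterate-ℛ {f} fᶜ = rec (var 0F) (app₁ fᶜ (var 1F))
  (λ { (_ ∷ []) → refl })
  -- `iterate` moves `f` onto the start value, whereas `prec` applies it to the previous result;
  -- `iterate-is-fold` reconciles the two.
  (λ { k (x ∷ []) → trans (cong f (sym (iterate-is-fold x f k)))
                          (iterate-is-fold x f (suc k)) })

-- Cantor–Bernstein for expanding injections

-- h n > n makes the range of h decidable by bounded search.
record IsExpanding (h : ℕ → ℕ) : Set where
  field
    computable : ℛ₁ h
    injective  : Injective _≡_ _≡_ h
    expanding  : ∀ n → n < h n

∘-isExpanding : ∀ {f h} → IsExpanding f → IsExpanding h → IsExpanding (f ∘ h)
∘-isExpanding {h = h} F H = record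
  { computable = ℛ-ext (λ { (_ ∷ []) → refl })
                   (app₁ F.computable (app₁ H.computable (var 0F)))
  ; injective  = H.injective ∘ F.injective
  ; expanding  = λ n → <-trans (H.expanding n) (F.expanding (h n))
  }
  where
  module F = IsExpanding F
  module H = IsExpanding H

-- A right inverse of h on its range; junk elsewhere.
preimage : (ℕ → ℕ) → ℕ → ℕ
preimage h x = search (λ w → ifEq (h w) x 0 1) x

ifRange : (ℕ → ℕ) → ℕ → ℕ → ℕ → ℕ
ifRange h x = ifEq (h (preimage h x)) x

retract : (ℕ → ℕ) → ℕ → ℕ
retract h x = ifRange h x (preimage h x) x

-- For expanding `h` each proper step back lowers the argument, so `x` steps reach the origin of the
-- chain, a point outside the range of `h`.
root : (ℕ → ℕ) → ℕ → ℕ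
root h x = iterate (retract h) x x

iterate-fixed : ∀ {f : ℕ → ℕ} {x} → f x ≡ x → ∀ n → iterate f x n ≡ x
iterate-fixed fx≡x zero    = refl
iterate-fixed {f} {x} fx≡x (suc n) rewrite fx≡x = iterate-fixed fx≡x n

-- A step either fixes the argument for good or lowers it, so nothing changes after the first `x`
-- steps.
iterate-stable : ∀ {f} → (∀ x → f x ≡ x ⊎ f x < x) →
                 ∀ m n {x} → x ≤ m → x ≤ n → iterate f x m ≡ iterate f x n
iterate-stable {f} decreasing m n {x} x≤m x≤n with decreasing x
... | inj₁ fx≡x = trans (iterate-fixed fx≡x m) (sym (iterate-fixed fx≡x n))
iterate-stable decreasing zero    n       z≤n x≤n | inj₂ ()
iterate-stable decreasing (suc m) zero    x≤m z≤n | inj₂ ()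
iterate-stable decreasing (suc m) (suc n) x≤m x≤n | inj₂ fx<x =
  iterate-stable decreasing m n (≤-pred (≤-trans fx<x x≤m)) (≤-pred (≤-trans fx<x x≤n))

module _ {h : ℕ → ℕ} (H : IsExpanding h) where
  open IsExpanding H

  h∘preimage : ∀ {w x} → h w ≡ x → h (preimage h x) ≡ x
  h∘preimage {w} refl = ifEq-true
    (search-finds (λ v → ifEq (h v) (h w) 0 1) (h w) (expanding w) (ifEq-yes {h w} refl))

  preimage∘h : ∀ w → preimage h (h w) ≡ w
  preimage∘h w = injective (h∘preimage refl)

  ifRange-yes : ∀ {w x y z} → h w ≡ x → ifRange h x y z ≡ y
  ifRange-yes hw≡x = ifEq-yes (h∘preimage hw≡x)

  ifRange-no : ∀ {x y z} → (∀ w → h w ≢ x) → ifRange h x y z ≡ z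
  ifRange-no x∉h = ifEq-no (x∉h _)

  range? : ∀ x → (∃[ w ] h w ≡ x) ⊎ (∀ w → h w ≢ x)
  range? x with h (preimage h x) ≟ x
  ... | yes eq = inj₁ (preimage h x , eq)
  ... | no neq = inj₂ λ w hw≡x → neq (h∘preimage hw≡x)

  retract-hit : ∀ w → retract h (h w) ≡ w
  retract-hit w = trans (ifRange-yes {w} refl) (preimage∘h w)

  retract-decreasing : ∀ x → retract h x ≡ x ⊎ retract h x < x
  retract-decreasing x with range? x
  ... | inj₁ (w , refl) = inj₂ (subst (_< h w) (sym (retract-hit w)) (expanding w))
  ... | inj₂ x∉h        = inj₁ (ifRange-no x∉h)

  root-miss : ∀ {x} → (∀ w → h w ≢ x) → root h x ≡ x
  root-miss {x} x∉h = iterate-fixed (ifRange-no x∉h) x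

  -- The first of the `h w` iterations leads back to `w`; at least `w` remain, enough to reach the
  -- same origin.
  root-hit : ∀ w → root h (h w) ≡ root h w
  root-hit w with h w | expanding w | retract-hit w
  ... | suc d | w<1+d | eq rewrite eq =
    iterate-stable retract-decreasing d w (≤-pred w<1+d) ≤-refl

  preimage-ℛ : ℛ₁ (preimage h)
  preimage-ℛ = ℛ-ext (λ { (_ ∷ []) → refl }) (search-ℛ
    (ifEq-ℛ (app₁ computable (var 0F)) (var 1F) zero-ℛ (app₁ suc-ℛ zero-ℛ)) (var 0F))

  ifRange-ℛ : ∀ {n} {x y z : Vec ℕ n → ℕ} → ℛ n x → ℛ n y → ℛ n z →
              ℛ n (λ xs → ifRange h (x xs) (y xs) (z xs))
  ifRange-ℛ xᶜ = ifEq-ℛ (app₁ computable (app₁ preimage-ℛ xᶜ)) xᶜ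

  root-ℛ : ℛ₁ (root h)
  root-ℛ = curry₁ (app₂ (iterate-ℛ retract-ℛ) (var 0F) (var 0F))
    where
    retract-ℛ : ℛ₁ (retract h)
    retract-ℛ = curry₁ (ifRange-ℛ (var 0F) (app₁ preimage-ℛ (var 0F)) (var 0F))

module _ {a c : ℕ → ℕ} (Aᵉ : IsExpanding a) (Cᵉ : IsExpanding c) where
  private
    module A = IsExpanding Aᵉ
    module C = IsExpanding Cᵉ
    H = ∘-isExpanding Cᵉ Aᵉ

  -- With `a` going right and `c` going left, the root is the earliest left-hand point of the chain
  -- of `x`. It lies in the range of `c` exactly when the chain starts one step further back, on the
  -- right.
  cantorBernstein : ℕ → ℕ
  cantorBernstein x = ifRange c (root (c ∘ a) x) (preimage c x) (a x)

  cantorBernstein-ℛ : ℛ₁ cantorBernstein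
  cantorBernstein-ℛ = curry₁ (ifRange-ℛ Cᵉ (app₁ (root-ℛ H) (var 0F))
    (app₁ (preimage-ℛ Cᵉ) (var 0F)) (app₁ A.computable (var 0F)))

  private
    g = cantorBernstein

    -- The chain of x starts on the right-hand side.
    Rooted : Pred ℕ 0ℓ
    Rooted x = ∃[ y ] c y ≡ root (c ∘ a) x

    rooted-c∘a : ∀ {x} → Rooted x → Rooted (c (a x))
    rooted-c∘a {x} (y , eq) = y , trans eq (sym (root-hit H x))

    rooted-c∘a⁻¹ : ∀ {x} → Rooted (c (a x)) → Rooted x
    rooted-c∘a⁻¹ {x} (y , eq) = y , trans eq (root-hit H x)

    ∉c⇒¬rooted : ∀ {x} → (∀ y → c y ≢ x) → ¬ Rooted x
    ∉c⇒¬rooted x∉c (y , eq) = x∉c y (trans eq (root-miss H (x∉c ∘ a)))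

    -- As `c` is injective, `c y` has no predecessor under `c ∘ a`, so it is its own root.
    ∉a⇒rooted : ∀ {y} → (∀ x → a x ≢ y) → Rooted (c y)
    ∉a⇒rooted {y} y∉a = y , sym (root-miss H λ x → y∉a x ∘ C.injective)

  cantorBernstein-cases : ∀ x → (Rooted x × c (g x) ≡ x) ⊎ (¬ Rooted x × g x ≡ a x)
  cantorBernstein-cases x with range? Cᵉ (root (c ∘ a) x)
  ... | inj₂ ¬rooted = inj₂ ((λ (y , eq) → ¬rooted y eq) , ifRange-no Cᵉ ¬rooted)
  ... | inj₁ rooted@(y , eq) with range? Cᵉ x
  ...   | inj₁ (w , cw≡x) = inj₁ (rooted ,
            trans (cong c (ifRange-yes Cᵉ eq)) (h∘preimage Cᵉ cw≡x))
  ...   | inj₂ x∉c        = contradiction rooted (∉c⇒¬rooted x∉c)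

  cantorBernstein-bijective : Bijective _≡_ _≡_ cantorBernstein
  cantorBernstein-bijective = injective , λ y →
    let x , gx≡y = surjective y in x , λ { refl → gx≡y }
    where
    -- A common value would give `x ≡ c (g x) ≡ c (a x′)`, placing `x` and `x′` on one chain, yet
    -- only `x` is rooted.
    mixed : ∀ {x x′} → Rooted x → c (g x) ≡ x → ¬ Rooted x′ → g x′ ≡ a x′ → g x ≢ g x′
    mixed rooted cgx≡x ¬rooted gx′≡ax′ eq = ¬rooted (rooted-c∘a⁻¹
      (subst Rooted (trans (sym cgx≡x) (cong c (trans eq gx′≡ax′))) rooted))

    injective : Injective _≡_ _≡_ g
    injective {x} {x′} eq with cantorBernstein-cases x | cantorBernstein-cases x′
    ... | inj₁ (_ , p) | inj₁ (_ , q) = trans (sym p) (trans (cong c eq) q)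
    ... | inj₂ (_ , p) | inj₂ (_ , q) = A.injective (trans (sym p) (trans eq q))
    ... | inj₁ (r , p) | inj₂ (s , q) = contradiction eq (mixed r p s q)
    ... | inj₂ (s , q) | inj₁ (r , p) = contradiction (sym eq) (mixed r p s q)

    surjective : ∀ y → ∃[ x ] g x ≡ y
    surjective y with cantorBernstein-cases (c y)
    ... | inj₁ (_ , eq) = c y , C.injective eq
    -- Now `y` must be some `a x`, or `c y` would be rooted; `x` shares the chain of `c y`, so `g`
    -- sends it to `a x`.
    ... | inj₂ (¬rooted , _) with range? Aᵉ y
    ...   | inj₂ y∉a        = contradiction (∉a⇒rooted y∉a) ¬rooted
    ...   | inj₁ (x , refl) with cantorBernstein-cases x
    ...     | inj₂ (_ , gx≡ax)  = x , gx≡ax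
    ...     | inj₁ (rooted , _) = contradiction (rooted-c∘a rooted) ¬rooted

-- Projections of the pairing and enumerations of extended graphs

Range-cong : ∀ {f g} {X : Pred ℕ 0ℓ} → (∀ s → f s ≡ g s) → Range g ≐ X → Range f ≐ X
Range-cong f≗g (to , from) =
  (λ { (s , refl) → to (s , sym (f≗g s)) }) ,
  λ y∈X → let s , eq = from y∈X in s , trans (f≗g s) eq

module _ (P : Pairing) where
  open Pairing P

  pair-ℛ : ∀ {n} {x y : Vec ℕ n → ℕ} → ℛ n x → ℛ n y → ℛ n (λ xs → ⟨ x xs , y xs ⟩)
  pair-ℛ = app₂ computable

  opaque
    -- The second component of `z` if `x` is the first, junk otherwise. Since `y ≤ ⟨ x , y ⟩` and
    -- the search bound is exclusive, `suc z` suffices.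
    partner : ℕ → ℕ → ℕ
    partner x z = search (λ y → ifEq ⟨ x , y ⟩ z 0 1) (suc z)

    isLeft : ℕ → ℕ → ℕ
    isLeft z x = ifEq ⟨ x , partner x z ⟩ z 0 1

    π₁ : ℕ → ℕ
    π₁ z = search (isLeft z) (suc z)

    π₂ : ℕ → ℕ
    π₂ z = partner (π₁ z) z

    partner-ℛ : ℛ₂ partner
    partner-ℛ = ℛ-ext (λ { (_ ∷ _ ∷ []) → refl }) (search-ℛ
      (ifEq-ℛ (pair-ℛ (var 1F) (var 0F)) (var 2F) zero-ℛ (app₁ suc-ℛ zero-ℛ))
      (app₁ suc-ℛ (var 1F)))

    π₁-ℛ : ℛ₁ π₁
    π₁-ℛ = ℛ-ext (λ { (_ ∷ []) → refl }) (search-ℛ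
      (ifEq-ℛ (pair-ℛ (var 0F) (app₂ partner-ℛ (var 0F) (var 1F))) (var 1F)
              zero-ℛ (app₁ suc-ℛ zero-ℛ))
      (app₁ suc-ℛ (var 0F)))

    π₂-ℛ : ℛ₁ π₂
    π₂-ℛ = curry₁ (app₂ partner-ℛ (app₁ π₁-ℛ (var 0F)) (var 0F))

    -- For `z ≡ ⟨ x , y ⟩`, `y` witnesses the inner search and hence `x` the outer one; the
    -- successful outer test is the claimed equation.
    ⟨π₁,π₂⟩ : ∀ z → ⟨ π₁ z , π₂ z ⟩ ≡ z
    ⟨π₁,π₂⟩ z with proj₂ bijective z
    ... | (x , y) , sur with sur refl
    ...   | refl = ifEq-true (search-finds (isLeft z) (suc z) (s≤s (≥-fst x y))
      (ifEq-yes (ifEq-true (search-finds (λ y′ → ifEq ⟨ x , y′ ⟩ z 0 1) (suc z)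
        (s≤s (≥-snd x y)) (ifEq-yes {z} refl)))))

  ⟨,⟩-injective : ∀ {x x′ y y′} → ⟨ x , y ⟩ ≡ ⟨ x′ , y′ ⟩ → (x , y) ≡ (x′ , y′)
  ⟨,⟩-injective = proj₁ bijective

  π₁-⟨,⟩ : ∀ x y → π₁ ⟨ x , y ⟩ ≡ x
  π₁-⟨,⟩ x y = cong proj₁ (⟨,⟩-injective (⟨π₁,π₂⟩ ⟨ x , y ⟩))

  π₂-⟨,⟩ : ∀ x y → π₂ ⟨ x , y ⟩ ≡ y
  π₂-⟨,⟩ x y = cong proj₂ (⟨,⟩-injective (⟨π₁,π₂⟩ ⟨ x , y ⟩))

  constEnum : ℕ → ℕ → ℕ
  constEnum c s = ⟨ π₁ s , ifZero (π₂ s) 0 (suc c) ⟩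

  constEnum-ℛ : ℛ₂ constEnum
  constEnum-ℛ = curry₂ (pair-ℛ (app₁ π₁-ℛ (var 1F))
    (app₃ ifZero-ℛ (app₁ π₂-ℛ (var 1F)) zero-ℛ (app₁ suc-ℛ (var 0F))))

  constEnum-range : ∀ c → Range (constEnum c) ≐ extendedGraph₁ P (total λ _ → c)
  constEnum-range c = to , from
    where
    to : ∀ {z} → Range (constEnum c) z → extendedGraph₁ P (total λ _ → c) z
    to (s , refl) with π₂ s
    ... | zero  = inj₁ (π₁ s , refl)
    ... | suc _ = inj₂ (π₁ s , c , refl , refl)

    value : ∀ x b → constEnum c ⟨ x , b ⟩ ≡ ⟨ x , ifZero b 0 (suc c) ⟩
    value x b = cong₂ (λ x b → ⟨ x , ifZero b 0 (suc c) ⟩) (π₁-⟨,⟩ x b) (π₂-⟨,⟩ x b)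

    from : ∀ {z} → extendedGraph₁ P (total λ _ → c) z → Range (constEnum c) z
    from (inj₁ (y , refl))            = ⟨ y , 0 ⟩ , value y 0
    from (inj₂ (x , _ , refl , refl)) = ⟨ x , 1 ⟩ , value x 1

  const∈𝒮 : ∀ A c → total (λ _ → c) ∈ 𝒮 A
  const∈𝒮 A c = inj₁ ((λ _ → c) , curry₁ (const-ℛ c) , id , id)

  -- Uniform enumeration of the functions of a quasi-Gödel numbering

  module Enumeration {A : Pred ℕ 0ℓ} {θ : ℕ → PFun ℕ}
                     (Θ : IsQuasiGödelNumbering P A θ) where
    open IsQuasiGödelNumbering Θ

    private
      F   = proj₁ QGN-I
      F-ℛ = proj₁ (proj₂ QGN-I)

    -- Filters the enumeration of the whole numbering. Entries for other indices become `⟨ 0 , 0 ⟩`,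
    -- which lies in every extended graph.
    enum : ℕ → ℕ → ℕ
    enum i t = ifEq (π₁ (π₁ (F t))) i ⟨ π₂ (π₁ (F t)) , π₂ (F t) ⟩ ⟨ 0 , 0 ⟩

    enum-ℛ : ℛ₂ enum
    enum-ℛ = curry₂ (ifEq-ℛ (app₁ π₁-ℛ (app₁ π₁-ℛ Ft)) (var 0F)
      (pair-ℛ (app₁ π₂-ℛ (app₁ π₁-ℛ Ft)) (app₁ π₂-ℛ Ft)) (pair-ℛ zero-ℛ zero-ℛ))
      where
      Ft : ℛ 2 (λ xs → F (lookup xs 1F))
      Ft = app₁ F-ℛ (var 1F)

    enum-range : ∀ i → Range (enum i) ≐ extendedGraph₁ P (θ i)
    enum-range i = to , from
      where
      value : ∀ {t} j x w → F t ≡ ⟨ ⟨ j , x ⟩ , w ⟩ →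
              enum i t ≡ ifEq j i ⟨ x , w ⟩ ⟨ 0 , 0 ⟩
      value j x w eq rewrite eq | π₁-⟨,⟩ ⟨ j , x ⟩ w | π₂-⟨,⟩ ⟨ j , x ⟩ w
                           | π₁-⟨,⟩ j x | π₂-⟨,⟩ j x = refl

      to : ∀ {z} → Range (enum i) z → extendedGraph₁ P (θ i) z
      to (t , refl) with proj₂ (proj₂ (proj₂ QGN-I)) (t , refl)
      to (t , refl) | inj₁ (j , x , eq) with j ≟ i
      ... | yes j≡i = inj₁ (x , trans (value j x 0 eq) (ifEq-yes j≡i))
      ... | no  j≢i = inj₁ (0 , trans (value j x 0 eq) (ifEq-no j≢i))
      to (t , refl) | inj₂ (j , x , v , xv , eq) with j ≟ i
      ... | yes refl = inj₂ (x , v , xv , trans (value j x (suc v) eq) (ifEq-yes {j} refl))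
      ... | no  j≢i  = inj₁ (0 , trans (value j x (suc v) eq) (ifEq-no j≢i))

      from : ∀ {z} → extendedGraph₁ P (θ i) z → Range (enum i) z
      from (inj₁ (y , refl)) with proj₁ (proj₂ (proj₂ QGN-I)) (inj₁ (i , y , refl))
      ... | t , eq = t , trans (value i y 0 eq) (ifEq-yes {i} refl)
      from (inj₂ (x , v , xv , refl))
        with proj₁ (proj₂ (proj₂ QGN-I)) (inj₂ (i , x , v , xv , refl))
      ... | t , eq = t , trans (value i x (suc v) eq) (ifEq-yes {i} refl)

    -- The recursion theorem with parameters

    module RecursionTheorem {B : ℕ → ℕ → ℕ → ℕ} (B-ℛ : ℛ₃ B) where

      private
        -- Processes an entry `w` of the extended graph of the function with index `π₁ z`. Only
        -- `⟨ z , suc e ⟩` reveals its value `e` at `z`, the index handed to `B`; all else yields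
        -- the harmless `⟨ 0 , 0 ⟩`.
        act : ℕ → ℕ → ℕ → ℕ
        act z w s = ifEq (π₁ w) z
          (ifZero (π₂ w) ⟨ 0 , 0 ⟩ (B (π₂ z) (pred (π₂ w)) s)) ⟨ 0 , 0 ⟩

        -- Dovetails: `π₁ t` is the stage of `enum`, `π₂ t` that of `B`.
        k : ℕ → ℕ → ℕ
        k z t = act z (enum (π₁ z) (π₁ t)) (π₂ t)

        opaque
          act-ℛ : ℛ₃ act
          act-ℛ = curry₃ (ifEq-ℛ (app₁ π₁-ℛ (var 1F)) (var 0F)
            (app₃ ifZero-ℛ (app₁ π₂-ℛ (var 1F)) (pair-ℛ zero-ℛ zero-ℛ)
              (app₃ B-ℛ (app₁ π₂-ℛ (var 0F)) (app₁ pred-ℛ (app₁ π₂-ℛ (var 1F))) (var 2F)))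
            (pair-ℛ zero-ℛ zero-ℛ))

          k-ℛ : ℛ₂ k
          k-ℛ = curry₂ (app₃ act-ℛ (var 0F)
            (app₂ enum-ℛ (app₁ π₁-ℛ (var 0F)) (app₁ π₁-ℛ (var 1F))) (app₁ π₂-ℛ (var 1F)))

        v       = proj₁ (QGN-II k k-ℛ)
        v-ℛ     = proj₁ (proj₂ (QGN-II k k-ℛ))
        v-index = proj₂ (proj₂ (QGN-II k k-ℛ))

        -- Being total and computable, `v` belongs to `𝒮 A` and so has an index.
        v-onto = IsNumbering.onto isNumbering (total v) (inj₁ (v , v-ℛ , id , id))
        m      = proj₁ v-onto

        act-value : ∀ {z} x w s → act z ⟨ x , w ⟩ s ≡
                    ifEq x z (ifZero w ⟨ 0 , 0 ⟩ (B (π₂ z) (pred w) s)) ⟨ 0 , 0 ⟩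
        act-value x w s rewrite π₁-⟨,⟩ x w | π₂-⟨,⟩ x w = refl

        act-zero : ∀ {z} y s → act z ⟨ y , 0 ⟩ s ≡ ⟨ 0 , 0 ⟩
        act-zero {z} y s with y ≟ z
        ... | yes y≡z = trans (act-value y 0 s) (ifEq-yes y≡z)
        ... | no  y≢z = trans (act-value y 0 s) (ifEq-no y≢z)

        act-miss : ∀ {z x} w s → x ≢ z → act z ⟨ x , w ⟩ s ≡ ⟨ 0 , 0 ⟩
        act-miss w s x≢z = trans (act-value _ w s) (ifEq-no x≢z)

        act-hit : ∀ z e s → act z ⟨ z , suc e ⟩ s ≡ B (π₂ z) e s
        act-hit z e s = trans (act-value z (suc e) s) (ifEq-yes {z} refl)

      -- Kleene's fixed point: if θ_m is total with values v, then k ⟨ m , u ⟩ enumerates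
      -- the range of B u (v ⟨ m , u ⟩); here m is an index of the very v that QGN-II
      -- yields for k.
      opaque
        fix : ℕ → ℕ
        fix u = v ⟨ m , u ⟩

        fix-ℛ : ℛ₁ fix
        fix-ℛ = curry₁ (app₁ v-ℛ (pair-ℛ (const-ℛ m) (var 0F)))

        fix-index : ∀ u r → r ∈ 𝒮 A →
                    Range (B u (fix u)) ≐ extendedGraph₁ P r → r ≈ θ (fix u)
        fix-index u r r∈𝒮 (B⊆r , r⊆B) = v-index z r r∈𝒮 (to , from)
          where
          z : ℕ
          z = ⟨ m , u ⟩

          m-range : Range (enum (π₁ z)) ≐ extendedGraph₁ P (θ m)
          m-range = subst (λ i → Range (enum i) ≐ _) (sym (π₁-⟨,⟩ m u)) (enum-range m)

          B≡ : ∀ s → B (π₂ z) (fix u) s ≡ B u (fix u) s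
          B≡ s = cong (λ u′ → B u′ (fix u) s) (π₂-⟨,⟩ m u)

          act∈ : ∀ {w} s → extendedGraph₁ P (θ m) w → extendedGraph₁ P r (act z w s)
          act∈ s (inj₁ (y , refl)) = inj₁ (0 , act-zero y s)
          act∈ s (inj₂ (x , e , θmxe , refl)) with x ≟ z
          ... | no  x≢z  = inj₁ (0 , act-miss (suc e) s x≢z)
          -- `θ m` has the values of `v`, so the entry at `z` carries `v z`, which is `fix u`.
          ... | yes refl with proj₂ (proj₂ v-onto) θmxe
          ...   | refl = B⊆r (s , sym (trans (act-hit z (fix u) s) (B≡ s)))

          to : ∀ {y} → Range (k z) y → extendedGraph₁ P r y
          to (t , refl) = act∈ (π₂ t) (proj₁ m-range (π₁ t , refl))

          from : ∀ {y} → extendedGraph₁ P r y → Range (k z) y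
          -- Pairs a stage `t` revealing the value of `θ m` at `z` with a stage `s` at which `B`
          -- lists the element.
          from y∈r with r⊆B y∈r
                      | proj₂ m-range (inj₂ (z , fix u , proj₁ (proj₂ v-onto) refl , refl))
          ... | s , refl | t , eq = ⟨ t , s ⟩ , (begin
            act z (enum (π₁ z) (π₁ ⟨ t , s ⟩)) (π₂ ⟨ t , s ⟩)
              ≡⟨ cong₂ (λ t s → act z (enum (π₁ z) t) s) (π₁-⟨,⟩ t s) (π₂-⟨,⟩ t s) ⟩
            act z (enum (π₁ z) t) s    ≡⟨ cong (λ w → act z w s) eq ⟩
            act z ⟨ z , suc (fix u) ⟩ s  ≡⟨ act-hit z (fix u) s ⟩
            B (π₂ z) (fix u) s         ≡⟨ B≡ s ⟩
            B u (fix u) s              ∎)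
            where open ≡-Reasoning

  -- Padding and expanding reductions between numberings

  record IsPaddedReduction (θ θ′ : ℕ → PFun ℕ) (f : ℕ → ℕ) : Set where
    field
      isExpanding : IsExpanding f
      reduces     : ∀ i → θ i ≈ θ′ (f i)

  module _ {A : Pred ℕ 0ℓ} {θ θ′ : ℕ → PFun ℕ}
           (Θ  : IsQuasiGödelNumbering P A θ) (Θ′ : IsQuasiGödelNumbering P A θ′) where
    private
      module E = Enumeration Θ

      -- The parameter `u` codes `⟨ ⟨ i , b ⟩ , c ⟩`: the function `θ i` to copy, the bound `b` to
      -- exceed and the fallback constant `c`.
      B : ℕ → ℕ → ℕ → ℕ
      B u e s = ifLe (suc (π₂ (π₁ u))) e (E.enum (π₁ (π₁ u)) s) (constEnum (π₂ u) s)

      opaque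
        B-ℛ : ℛ₃ B
        B-ℛ = curry₃ (ifLe-ℛ (app₁ suc-ℛ (app₁ π₂-ℛ (app₁ π₁-ℛ (var 0F)))) (var 1F)
          (app₂ E.enum-ℛ (app₁ π₁-ℛ (app₁ π₁-ℛ (var 0F))) (var 2F))
          (app₂ constEnum-ℛ (app₁ π₂-ℛ (var 0F)) (var 2F)))

      open Enumeration.RecursionTheorem Θ′ B-ℛ

      candidate : ℕ → ℕ → ℕ → ℕ
      candidate i b c = fix ⟨ ⟨ i , b ⟩ , c ⟩

      opaque
        candidate-ℛ : ℛ₃ candidate
        candidate-ℛ = curry₃ (app₁ fix-ℛ (pair-ℛ (pair-ℛ (var 0F) (var 1F)) (var 2F)))

      B-value : ∀ i b c e s → B ⟨ ⟨ i , b ⟩ , c ⟩ e s ≡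
                ifLe (suc b) e (E.enum i s) (constEnum c s)
      B-value i b c e s rewrite π₁-⟨,⟩ ⟨ i , b ⟩ c | π₂-⟨,⟩ ⟨ i , b ⟩ c
                              | π₁-⟨,⟩ i b | π₂-⟨,⟩ i b = refl

      candidate-above : ∀ i b c → b < candidate i b c → θ i ≈ θ′ (candidate i b c)
      candidate-above i b c b<e = fix-index ⟨ ⟨ i , b ⟩ , c ⟩ (θ i)
        (IsNumbering.member (IsQuasiGödelNumbering.isNumbering Θ) i)
        (Range-cong (λ s → trans (B-value i b c _ s) (ifLe-yes b<e)) (E.enum-range i))

      candidate-below : ∀ i b c → ¬ b < candidate i b c →
                        total (λ _ → c) ≈ θ′ (candidate i b c)
      candidate-below i b c b≮e = fix-index ⟨ ⟨ i , b ⟩ , c ⟩ (total λ _ → c) (const∈𝒮 A c)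
        (Range-cong (λ s → trans (B-value i b c _ s) (ifLe-no b≮e)) (constEnum-range c))

      -- Tries `b + 2` constants, one more than there are indices not exceeding `b`.
      choice : ℕ → ℕ → ℕ
      choice i b = search (λ c → ifLe (suc b) (candidate i b c) 0 1) (suc (suc b))

      pad : ℕ → ℕ → ℕ
      pad i b = candidate i b (choice i b)

      pad-above : ∀ i b → b < pad i b
      pad-above i b with b <? pad i b
      ... | yes b<pad = b<pad
      ... | no  b≮pad = contradiction same-const (<⇒≢ c₀<c₁)
        where
        -- One good candidate would make the search succeed, so if `pad i b` fails, all candidates
        -- fail.
        below : (c : Fin (suc (suc b))) → ¬ b < candidate i b (toℕ c)
        below c b<e = contradiction
          (trans (sym (search-finds (λ c → ifLe (suc b) (candidate i b c) 0 1)
                        (suc (suc b)) (toℕ<n c) (ifLe-yes b<e)))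
                 (ifLe-no b≮pad)) 0≢1+n

        collision = pigeonhole (n<1+n (suc b)) λ c → fromℕ< (s≤s (≮⇒≥ (below c)))
        c₀  = proj₁ collision
        c₁  = proj₁ (proj₂ collision)
        c₀<c₁ : toℕ c₀ < toℕ c₁
        c₀<c₁ = proj₁ (proj₂ (proj₂ collision))

        same-index : candidate i b (toℕ c₀) ≡ candidate i b (toℕ c₁)
        same-index = trans (sym (toℕ-fromℕ< _))
          (trans (cong toℕ (proj₂ (proj₂ (proj₂ collision)))) (toℕ-fromℕ< _))

        -- The shared index denotes both constant functions; their values are compared at `0`.
        same-const : toℕ c₀ ≡ toℕ c₁
        same-const = functional (θ′ (candidate i b (toℕ c₁)))
          (subst (λ e → graph (θ′ e) 0 (toℕ c₀)) same-index
            (proj₁ (candidate-below i b (toℕ c₀) (below c₀)) {0} refl))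
          (proj₁ (candidate-below i b (toℕ c₁) (below c₁)) refl)

      pad-ℛ : ℛ₂ pad
      pad-ℛ = curry₂ (app₃ candidate-ℛ (var 0F) (var 1F) (app₂ choice-ℛ (var 0F) (var 1F)))
        where
        choice-ℛ : ℛ₂ choice
        choice-ℛ = ℛ-ext (λ { (_ ∷ _ ∷ []) → refl }) (search-ℛ
          (ifLe-ℛ (app₁ suc-ℛ (var 2F)) (app₃ candidate-ℛ (var 1F) (var 2F) (var 0F))
                  zero-ℛ (app₁ suc-ℛ zero-ℛ))
          (app₁ suc-ℛ (app₁ suc-ℛ (var 1F))))

      -- Each value serves as the bound for the next, so `red` is strictly increasing; injectivity
      -- and `n < red n` follow.
      red : ℕ → ℕ
      red zero    = pad 0 0
      red (suc n) = pad (suc n) (red n)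

      red-ℛ : ℛ₁ red
      red-ℛ = rec (app₂ pad-ℛ zero-ℛ zero-ℛ)
        (app₂ pad-ℛ (app₁ suc-ℛ (var 0F)) (var 1F)) (λ { [] → refl }) (λ { _ [] → refl })

      red-mono : ∀ {m n} → m <′ n → red m < red n
      red-mono {m} <′-base        = pad-above (suc m) (red m)
      red-mono {n = suc n} (≤′-step m<n) =
        <-trans (red-mono m<n) (pad-above (suc n) (red n))

      red-expanding : ∀ n → n < red n
      red-expanding zero    = pad-above 0 0
      red-expanding (suc n) = ≤-<-trans (red-expanding n) (pad-above (suc n) (red n))

      red-injective : Injective _≡_ _≡_ red
      red-injective {m} {n} eq with <-cmp m n
      ... | tri< m<n _ _ = contradiction eq (<⇒≢ (red-mono (<⇒<′ m<n)))
      ... | tri≈ _ m≡n _ = m≡n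
      ... | tri> _ _ n<m = contradiction (sym eq) (<⇒≢ (red-mono (<⇒<′ n<m)))

      red-reduces : ∀ i → θ i ≈ θ′ (red i)
      red-reduces zero    = candidate-above 0 0 _ (pad-above 0 0)
      red-reduces (suc n) = candidate-above (suc n) (red n) _ (pad-above (suc n) (red n))

    paddedReduction : ∃ (IsPaddedReduction θ θ′)
    paddedReduction = red , record
      { isExpanding = record
          { computable = red-ℛ ; injective = red-injective ; expanding = red-expanding }
      ; reduces = red-reduces
      }

-- The isomorphism from padded reductions in both directions

theorem8p4 : (P : Pairing) (A : Pred ℕ 0ℓ) → Inf A → CE A →
    (θ θ′ : ℕ → PFun ℕ) →
    IsQuasiGödelNumbering P A θ → IsQuasiGödelNumbering P A θ′ →
    ∃[ g ] ℛ₁ g × Bijective _≡_ _≡_ g × (∀ i → θ i ≈ θ′ (g i))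
theorem8p4 P A _ _ θ θ′ Θ Θ′
  with paddedReduction P Θ Θ′ | paddedReduction P Θ′ Θ
... | a , a-red | c , c-red =
  g , cantorBernstein-ℛ aᵉ cᵉ , cantorBernstein-bijective aᵉ cᵉ , same
  where
  aᵉ = IsPaddedReduction.isExpanding a-red
  cᵉ = IsPaddedReduction.isExpanding c-red
  g  = cantorBernstein aᵉ cᵉ

  same : ∀ i → θ i ≈ θ′ (g i)
  same i with cantorBernstein-cases aᵉ cᵉ i
  ... | inj₂ (_ , gi≡ai) = subst (λ j → θ i ≈ θ′ j) (sym gi≡ai)
                             (IsPaddedReduction.reduces a-red i)
  -- Here `g i` is a preimage of `i` under `c`, so the reduction of `θ′` to `θ` is read backwards.
  ... | inj₁ (_ , cgi≡i) with IsPaddedReduction.reduces c-red (g i)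
  ...   | θ′⊆θ , θ⊆θ′ rewrite cgi≡i = θ⊆θ′ , θ′⊆θ
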